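{- Let $P$ be a poset. The following properties are equivalent: (i) the order on $P$ is the intersection of two scattered linear orders; (ii) (a) $P$ has a non-separating scattered linear extension, and (b) neither $\Omega(\eta)$ nor its dual $\Omega(\eta)^*$ is embeddable in $P$.
   Context: A poset (or its order) is scattered if it contains no induced subposet isomorphic to the chain of rational numbers. A poset is embeddable in another if it is isomorphic to an induced subposet of it. A linear extension $L$ of a poset $P$ is separating if there are $x,y,z\in P$ with $x<_P z$, $y$ incomparable (in $P$) with both $x$ and $z$, and $x<_L y<_L z$; otherwise it is non-separating. $\Omega(\eta)$ is the infinite binary tree in which each level is totally ordered increasingly from left to right: its underlying set is the set of finite $0$-$1$ sequences, and its order is the least order containing the initial-segment order ($s\leq t$ if $s$ is an initial segment of $t$) and, for sequences of equal length, the lexicographic order ($0<1$). Equivalently, $\Omega(\eta)$ is isomorphic to $\{(n,m/2^n): n,m\in\mathbb{N},\ 0\leq m<2^n\}$ ordered by $(n,a)\leq(n',a')$ iff $n\leq n'$ and $a\leq a'$. -}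

module Defs where

open import Level using (Level; _⊔_; 0ℓ) renaming (suc to lsuc)
open import Data.Bool.Base using (Bool; _<_)
import Data.Bool.Properties as Bool
open import Data.List.Base using (List; length)
open import Data.List.Relation.Binary.Lex.Strict as Lex using (Lex-≤)
open import Data.List.Relation.Binary.Pointwise as Pointwise using (Pointwise; Pointwise-≡⇒≡)
open import Data.List.Relation.Binary.Prefix.Heterogeneous using (Prefix; []; _∷_)
open import Data.Nat.Base as ℕ using (z≤n; s≤s)
import Data.Nat.Properties as ℕ
open import Data.Product.Base using (Σ; Σ-syntax; ∃-syntax; _×_; _,_; proj₁)
import Data.Rational.Properties as ℚ
open import Data.Sum.Base using (inj₁; inj₂)
open import Relation.Binary.Bundles using (Poset; DecTotalOrder)
open import Relation.Binary.Core using (Rel; _⇒_) renaming (_⇔_ to _≐_)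
open import Relation.Binary.Construct.Closure.ReflexiveTransitive using (Star; ε; _◅_)
import Relation.Binary.Construct.Closure.ReflexiveTransitive.Properties as Star
import Relation.Binary.Construct.Flip.EqAndOrd as Flip
open import Relation.Binary.Construct.Intersection using (_∩_)
import Relation.Binary.Construct.NonStrictToStrict as Strict
import Relation.Binary.Construct.On as On
open import Relation.Binary.Construct.Union using (_∪_)
open import Relation.Binary.Morphism.Structures using (IsOrderIsomorphism)
open import Relation.Binary.PropositionalEquality
  using (_≡_; refl; sym; isEquivalence; resp₂)
open import Relation.Binary.Structures using (IsTotalOrder)
open import Relation.Nullary.Negation using (¬_)
open import Relation.Unary using (Pred)

private
  variable
    a ℓ₁ ℓ₂ b ℓ₃ ℓ₄ ℓ : Level

infix 4 _≅_

_≅_ : Poset a ℓ₁ ℓ₂ → Poset b ℓ₃ ℓ₄ → Set (a ⊔ ℓ₁ ⊔ ℓ₂ ⊔ b ⊔ ℓ₃ ⊔ ℓ₄)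
P ≅ Q = ∃[ f ] IsOrderIsomorphism P._≈_ Q._≈_ P._≤_ Q._≤_ f
  where
  module P = Poset P
  module Q = Poset Q

Induced : (P : Poset a ℓ₁ ℓ₂) → Pred (Poset.Carrier P) ℓ → Poset (a ⊔ ℓ) ℓ₁ ℓ₂
Induced P S = On.poset P (proj₁ {B = S})

-- The level of S is that of the image of a map P → Q, so that every
-- order embedding of P determines such an S.
Embeddable : Poset a ℓ₁ ℓ₂ → Poset b ℓ₃ ℓ₄ → Set (lsuc (a ⊔ ℓ₃) ⊔ ℓ₁ ⊔ ℓ₂ ⊔ b ⊔ ℓ₄)
Embeddable {a = a} {ℓ₃ = ℓ₃} P Q =
  Σ[ S ∈ Pred (Poset.Carrier Q) (a ⊔ ℓ₃) ] P ≅ Induced Q S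

Scattered : Poset a ℓ₁ ℓ₂ → Set (a ⊔ lsuc ℓ₁ ⊔ ℓ₂)
Scattered P = ¬ Embeddable (DecTotalOrder.poset ℚ.≤-decTotalOrder) P

Dual : Poset a ℓ₁ ℓ₂ → Poset a ℓ₁ ℓ₂
Dual = Flip.poset

-- A linear order on the underlying set of P, unrelated to the order of P.
record LinearOrderOn (P : Poset a ℓ₁ ℓ₂) : Set (a ⊔ ℓ₁ ⊔ lsuc ℓ₂) where
  open Poset P using (Carrier; _≈_)
  infix 4 _≤_
  field
    _≤_          : Rel Carrier ℓ₂
    isTotalOrder : IsTotalOrder _≈_ _≤_

  open Strict _≈_ _≤_ public using (_<_)

  poset : Poset a ℓ₁ ℓ₂
  poset = record { isPartialOrder = IsTotalOrder.isPartialOrder isTotalOrder }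

module _ (P : Poset a ℓ₁ ℓ₂) where
  open Poset P using (Carrier; _≈_; _≤_)
  open Strict _≈_ _≤_ renaming (_<_ to _<ₚ_) using ()

  Incomparable : Rel Carrier ℓ₂
  Incomparable x y = ¬ (x ≤ y) × ¬ (y ≤ x)

  IsIntersectionOf : (L₁ L₂ : LinearOrderOn P) → Set (a ⊔ ℓ₂)
  IsIntersectionOf L₁ L₂ = _≤_ ≐ (LinearOrderOn._≤_ L₁ ∩ LinearOrderOn._≤_ L₂)

  IsLinearExtension : LinearOrderOn P → Set (a ⊔ ℓ₂)
  IsLinearExtension L = _≤_ ⇒ LinearOrderOn._≤_ L

  Separating : LinearOrderOn P → Set (a ⊔ ℓ₁ ⊔ ℓ₂)
  Separating L =
    ∃[ x ] ∃[ y ] ∃[ z ]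
      x <ₚ z × Incomparable y x × Incomparable y z × x L.< y × y L.< z
    where module L = LinearOrderOn L

SameLevelLex : Rel (List Bool) 0ℓ
SameLevelLex s t = length s ≡ length t × Lex-≤ _≡_ _<_ s t

infix 4 _≤Ω_

-- The least preorder containing both relations; it is antisymmetric
-- (≤Ω-antisym), hence also the least partial order containing them.
_≤Ω_ : Rel (List Bool) 0ℓ
_≤Ω_ = Star (Prefix _≡_ ∪ SameLevelLex)

prefix-length : ∀ {s t : List Bool} → Prefix _≡_ s t → length s ℕ.≤ length t
prefix-length []      = z≤n
prefix-length (_ ∷ p) = s≤s (prefix-length p)

prefix-full : ∀ {s t : List Bool} → Prefix _≡_ s t → length t ℕ.≤ length s →
              Pointwise _≡_ s t
prefix-full {t = List.[]} []     _       = Pointwise.[]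
prefix-full               (e ∷ p) (s≤s l) = e Pointwise.∷ prefix-full p l

step-length : ∀ {s t} → (Prefix _≡_ ∪ SameLevelLex) s t → length s ℕ.≤ length t
step-length (inj₁ p)       = prefix-length p
step-length (inj₂ (e , _)) = ℕ.≤-reflexive e

≤Ω-length : ∀ {s t} → s ≤Ω t → length s ℕ.≤ length t
≤Ω-length ε        = ℕ.≤-refl
≤Ω-length (x ◅ xs) = ℕ.≤-trans (step-length x) (≤Ω-length xs)

step-lex : ∀ {s t} → (Prefix _≡_ ∪ SameLevelLex) s t → length t ℕ.≤ length s →
           Lex-≤ _≡_ _<_ s t
step-lex (inj₁ p)       l = Lex.≤-reflexive _≡_ _<_ (prefix-full p l)
step-lex (inj₂ (_ , x)) l = x

≤Ω-lex : ∀ {s t} → s ≤Ω t → length t ℕ.≤ length s → Lex-≤ _≡_ _<_ s t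
≤Ω-lex ε        _ = Lex.≤-reflexive _≡_ _<_ (Pointwise.refl refl)
≤Ω-lex (x ◅ xs) l = Lex.≤-transitive isEquivalence (resp₂ _<_) Bool.<-trans
  (step-lex x (ℕ.≤-trans (≤Ω-length xs) l))
  (≤Ω-lex xs (ℕ.≤-trans l (step-length x)))

≤Ω-antisym : ∀ {s t} → s ≤Ω t → t ≤Ω s → s ≡ t
≤Ω-antisym p q = Pointwise-≡⇒≡
  (Lex.≤-antisymmetric sym Bool.<-irrefl Bool.<-asym
    (≤Ω-lex p (≤Ω-length q)) (≤Ω-lex q (≤Ω-length p)))

Ωη : Poset 0ℓ 0ℓ 0ℓ
Ωη = record
  { isPartialOrder = record
    { isPreorder = Star.isPreorder (Prefix _≡_ ∪ SameLevelLex)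
    ; antisym    = ≤Ω-antisym
    }
  }

{-# OPTIONS --safe #-}
module Submission where

-- (i) ⇒ (ii): a member of a pair of linear orders realizing P is non-separating,
-- as an element between x and z in one and incomparable to both must reverse in
-- the other. In Ω(η), with s placed at (length s, 0.s), any two incomparable pairs
-- are linked by comparabilities, so both orders of a realizer decide all of them
-- uniformly; the one that puts [0,0] before [1] extends the strict order of the
-- dyadic values 0.s, which is dense.
--
-- (ii) ⇒ (i): complement the non-separating extension L by the order L′ that
-- reverses L on incomparable pairs. Call a set large if it contains an L′-dense
-- subset; large sets are stable under halving. If L′ is not scattered, write x ≪ y
-- when the L-interval [x, y⟩ is large. Either ≪ is dense, and then L contains ℚ, or
-- there is an L′-dense set in which every final (or initial) L-segment remains
-- L′-dense, and in it Ω(η) (or its dual) is built point by point in shortlex order.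

open import Defs
open import Level using (Level; _⊔_; 0ℓ; Lift; lift; lower)
import Algebra.Properties.Group as Group
open import Axiom.ExcludedMiddle using (ExcludedMiddle)
open import Data.Bool.Base as Bool using (Bool; true; false; T; f<t)
open import Data.Bool.Properties using (T?)
import Data.Bool.Properties as Bool
open import Data.Empty using (⊥; ⊥-elim)
open import Data.Integer.Base as ℤ using (∣_∣; sign; _◃_)
import Data.Integer.Properties as ℤ
open import Data.List.Base using (List; []; _∷_; _++_; length; replicate)
open import Data.List.Properties using (length-replicate)
open import Data.List.Relation.Binary.Lex.Strict as Lex
  using (Lex-<; Lex-≤; base; halt; this; next)
open import Data.List.Relation.Binary.Pointwise using (Pointwise-≡⇒≡)
open import Data.List.Relation.Binary.Prefix.Heterogeneous using (Prefix; []; _∷_)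
open import Data.Nat.Base as ℕ using (ℕ; zero; suc; _^_; s≤s; z≤n)
import Data.Nat.Properties as ℕ
open import Data.Product.Base using (Σ-syntax; ∃-syntax; ∃; ∃₂; _×_; _,_; proj₁; proj₂)
open import Data.Rational.Base as ℚ using (ℚ; ↥_)
import Data.Rational.Properties as ℚ
open import Data.Sign.Base as Sign using (Sign)
open import Data.Sum.Base using (_⊎_; inj₁; inj₂)
open import Data.Unit.Base using (⊤; tt)
open import Function.Base using (_∘_; id; case_of_)
open import Function.Bundles using (_⇔_; mk⇔)
open import Relation.Binary.Bundles using (Poset; StrictTotalOrder; DecTotalOrder)
open import Relation.Binary.Core using (Rel)
open import Relation.Binary.Construct.Closure.ReflexiveTransitive using (ε; _◅_)
import Relation.Binary.Construct.Flip.EqAndOrd as Flip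
open import Relation.Binary.Definitions using (Transitive; Tri; tri<; tri≈; tri>)
open import Relation.Binary.Morphism.Structures using (IsOrderIsomorphism)
open import Relation.Binary.PropositionalEquality
  using (_≡_; refl; sym; trans; cong; subst; subst₂)
open import Relation.Binary.Structures using (IsTotalOrder)
open import Relation.Nullary using (Dec; yes; no)
open import Relation.Nullary.Decidable
  using (map′; ⌊_⌋; toWitness; fromWitness; decidable-stable; _×-dec_)
open import Relation.Nullary.Negation using (¬_; contradiction)
open import Relation.Unary using (Pred; _∩_; ∁; _⊆_)

private
  variable
    a b x r v ℓ ℓ′ ℓ₁ ℓ₂ ℓ₃ ℓ₄ : Level

private module ℚ⁺ = Group ℚ.+-0-group

-- Excluded middle at lower levels, and embeddings as maps

lowerEM : ∀ ℓ′ → ExcludedMiddle (ℓ ⊔ ℓ′) → ExcludedMiddle ℓ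
lowerEM ℓ′ em {A} = map′ lower lift (em {Lift ℓ′ A})

OrderEmbedding : Poset a ℓ₁ ℓ₂ → Poset b ℓ₃ ℓ₄ → Set (a ⊔ ℓ₂ ⊔ b ⊔ ℓ₄)
OrderEmbedding P Q = Σ[ f ∈ (P.Carrier → Q.Carrier) ]
  (∀ {x y} → x P.≤ y → f x Q.≤ f y) × (∀ {x y} → f x Q.≤ f y → x P.≤ y)
  where
  module P = Poset P
  module Q = Poset Q

module _ (P : Poset a ℓ₁ ℓ₂) (Q : Poset b ℓ₃ ℓ₄) where
  private
    module P = Poset P
    module Q = Poset Q

  -- The image of `f` is the induced subposet; congruence and injectivity come from antisymmetry.
  embeddable : OrderEmbedding P Q → Embeddable P Q
  embeddable (f , mono , cancel) =
    (λ y → ∃[ x ] f x Q.≈ y) , (λ x → f x , x , Q.Eq.refl) , record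
      { isOrderMonomorphism = record
        { isOrderHomomorphism = record { cong = f-cong ; mono = mono }
        ; injective = λ e → P.antisym (cancel (Q.reflexive e))
                                      (cancel (Q.reflexive (Q.Eq.sym e)))
        ; cancel = cancel
        }
      ; surjective = λ (_ , x , e) → x , λ z≈x → Q.Eq.trans (f-cong z≈x) e
      }
    where
    f-cong : ∀ {x y} → x P.≈ y → f x Q.≈ f y
    f-cong e = Q.antisym (mono (P.reflexive e)) (mono (P.reflexive (P.Eq.sym e)))

  orderEmbedding : Embeddable P Q → OrderEmbedding P Q
  orderEmbedding (_ , f , iso) = proj₁ ∘ f , mono , cancel
    where open IsOrderIsomorphism iso

-- Lexicographic and shortlex order on binary words

_<ᴸ_ : Rel (List Bool) 0ℓ
_<ᴸ_ = Lex-< _≡_ Bool._<_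

lexOrder : StrictTotalOrder 0ℓ 0ℓ 0ℓ
lexOrder = Lex.<-strictTotalOrder Bool.<-strictTotalOrder

module ᴸ = StrictTotalOrder lexOrder

-- The value of the binary numeral 1s, so that index order is shortlex order.
index : List Bool → ℕ
index []          = 1
index (false ∷ s) = 2 ^ length s ℕ.+ index s
index (true ∷ s)  = 2 ^ suc (length s) ℕ.+ index s

2^length≤index : ∀ s → 2 ^ length s ℕ.≤ index s
2^length≤index []          = ℕ.≤-refl
2^length≤index (false ∷ s) rewrite ℕ.+-identityʳ (2 ^ length s) =
  ℕ.+-monoʳ-≤ (2 ^ length s) (2^length≤index s)
2^length≤index (true ∷ s)  = ℕ.m≤m+n _ _

index<2^ : ∀ s → index s ℕ.< 2 ^ suc (length s)
index<2^ []          = ℕ.≤-refl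
index<2^ (false ∷ s) = ℕ.+-mono-≤-< (ℕ.^-monoʳ-≤ 2 (ℕ.n≤1+n (length s)))
  (ℕ.<-≤-trans (index<2^ s) (ℕ.m≤m+n _ 0))
index<2^ (true ∷ s)  = ℕ.+-monoʳ-< (2 ^ suc (length s))
  (ℕ.<-≤-trans (index<2^ s) (ℕ.m≤m+n _ 0))

index-length-mono : ∀ {s t} → length s ℕ.< length t → index s ℕ.< index t
index-length-mono {s} {t} l =
  ℕ.<-≤-trans (index<2^ s) (ℕ.≤-trans (ℕ.^-monoʳ-≤ 2 l) (2^length≤index t))

index-lex-mono : ∀ {s t} → length s ≡ length t → s <ᴸ t → index s ℕ.< index t
index-lex-mono {false ∷ s} {true ∷ t} e (this f<t)
  rewrite ℕ.suc-injective e | ℕ.+-comm (2 ^ length t) (index s) =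
  ℕ.+-mono-<-≤ (subst (λ n → index s ℕ.< 2 ^ suc n) (ℕ.suc-injective e) (index<2^ s))
               (2^length≤index t)
index-lex-mono {false ∷ s} {false ∷ t} e (next refl l) rewrite ℕ.suc-injective e =
  ℕ.+-monoʳ-< (2 ^ length t) (index-lex-mono (ℕ.suc-injective e) l)
index-lex-mono {true ∷ s} {true ∷ t} e (next refl l) rewrite ℕ.suc-injective e =
  ℕ.+-monoʳ-< (2 ^ suc (length t)) (index-lex-mono (ℕ.suc-injective e) l)

index-injective : ∀ {s t} → index s ≡ index t → s ≡ t
index-injective {s} {t} e with ℕ.<-cmp (length s) (length t) | ᴸ.compare s t
... | tri< l _ _ | _          = ⊥-elim (ℕ.<-irrefl e (index-length-mono {s} {t} l))
... | tri> _ _ l | _          = ⊥-elim (ℕ.<-irrefl (sym e) (index-length-mono {t} {s} l))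
... | tri≈ _ l _ | tri< s<t _ _ = ⊥-elim (ℕ.<-irrefl e (index-lex-mono l s<t))
... | tri≈ _ _ _ | tri≈ _ s≋t _ = Pointwise-≡⇒≡ s≋t
... | tri≈ _ l _ | tri> _ _ t<s = ⊥-elim (ℕ.<-irrefl (sym e) (index-lex-mono (sym l) t<s))

-- Enumerating the binary words and the rationals

module Enumeration (em : ExcludedMiddle 0ℓ) where

  enum : ℕ → List Bool
  enum n with em {∃[ s ] index s ≡ n}
  ... | yes (s , _) = s
  -- A default value for numbers that are no index, such as 0.
  ... | no  _       = []

  enum-index : ∀ s → enum (index s) ≡ s
  enum-index s with em {∃[ t ] index t ≡ index s}
  ... | yes (_ , e) = index-injective e
  ... | no  ¬e      = ⊥-elim (¬e (s , refl))

  -- Decodes a pair `(m , n)` written as `m` trues, one false and `n` further entries.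
  leadingTrues : List Bool → ℕ × ℕ
  leadingTrues []          = 0 , 0
  leadingTrues (false ∷ s) = 0 , length s
  leadingTrues (true ∷ s)  = let m , n = leadingTrues s in suc m , n

  leadingTrues-replicate : ∀ m n →
    leadingTrues (replicate m true ++ false ∷ replicate n true) ≡ (m , n)
  leadingTrues-replicate zero    n = cong (0 ,_) (length-replicate n)
  leadingTrues-replicate (suc m) n rewrite leadingTrues-replicate m n = refl

  toSign : Bool → Sign
  toSign true  = Sign.+
  toSign false = Sign.-

  fromSign : Sign → Bool
  fromSign Sign.+ = true
  fromSign Sign.- = false

  toSign-fromSign : ∀ s → toSign (fromSign s) ≡ s
  toSign-fromSign Sign.+ = refl
  toSign-fromSign Sign.- = refl

  decode : List Bool → ℚ
  decode []      = ℚ.0ℚ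
  decode (s ∷ t) = let m , n = leadingTrues t in (toSign s ◃ m) ℚ./ suc n

  encode : ℚ → List Bool
  encode q = fromSign (sign (↥ q)) ∷
    replicate ∣ ↥ q ∣ true ++ false ∷ replicate (ℚ.denominator-1 q) true

  decode-encode : ∀ q → decode (encode q) ≡ q
  decode-encode q
    rewrite leadingTrues-replicate ∣ ↥ q ∣ (ℚ.denominator-1 q)
          | toSign-fromSign (sign (↥ q))
          | ℤ.◃-inverse (↥ q) = ℚ.↥p/↧p≡p q

  enumℚ : ℕ → ℚ
  enumℚ = decode ∘ enum

  indexℚ : ℚ → ℕ
  indexℚ = index ∘ encode

  enumℚ-indexℚ : ∀ q → enumℚ (indexℚ q) ≡ q
  enumℚ-indexℚ q = trans (cong decode (enum-index (encode q))) (decode-encode q)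

-- Embedding an enumerated order into a dense relation

-- Cantor's back-and-forth argument, forth only: the n-th point of the
-- enumerated order A is sent into the R-interval that the earlier points
-- assign to it, and V-above the point chosen just before. With V trivial and
-- A = ℚ this embeds ℚ; with A the lexicographic order and V vertical it embeds Ω(η).
module Interpolation
  (A : StrictTotalOrder a ℓ₁ ℓ₂) (e : ℕ → StrictTotalOrder.Carrier A)
  {X : Set x} {_≺_ : Rel X ℓ} (≺-trans : Transitive _≺_)
  {R : Rel X r} (R⇒≺ : ∀ {x y} → R x y → x ≺ y)
  {V : Rel X v} (V-trans : Transitive V)
  (between : ∀ v {x y} → R x y → ∃[ z ] R x z × R z y × V v z)
  {lo hi : X} (lo-R-hi : R lo hi)
  where

  open StrictTotalOrder A using (_<_; compare; irrefl)
    renaming (Carrier to C; _≈_ to _≈A_; trans to <-trans; module Eq to ≈A)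

  -- The endpoints are `R`-related because only then does `between` supply a point; membership is by
  -- `≺`, which composes by `≺-trans`.
  Interval : Set _
  Interval = ∃₂ R

  _∈ᴵ_ : X → Interval → Set _
  x ∈ᴵ (l , u , _) = l ≺ x × x ≺ u

  Separated : Interval → Interval → Set _
  Separated I J = ∀ {x y} → x ∈ᴵ I → y ∈ᴵ J → x ≺ y

  pivot : X → Interval → X
  pivot v (_ , _ , p) = proj₁ (between v p)

  pivot-∈ : ∀ v I → pivot v I ∈ᴵ I
  pivot-∈ v (_ , _ , p) = let _ , l , u , _ = between v p in R⇒≺ l , R⇒≺ u

  V-pivot : ∀ v I → V v (pivot v I)
  V-pivot v (_ , _ , p) = proj₂ (proj₂ (proj₂ (between v p)))

  -- A point equal to `p` is treated as if it lay above `p`: the enumeration may repeat points, and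
  -- a repetition still needs an image.
  narrow : ∀ {q p} → X → Tri (q < p) (q ≈A p) (p < q) → Interval → Interval
  narrow v (tri< _ _ _) (l , u , p) = let z , lz , zu , _ = between v p in l , z , lz
  narrow v (tri≈ _ _ _) (l , u , p) = let z , lz , zu , _ = between v p in z , u , zu
  narrow v (tri> _ _ _) (l , u , p) = let z , lz , zu , _ = between v p in z , u , zu

  narrow-⊆ : ∀ {q p} v (c : Tri (q < p) (q ≈A p) (p < q)) I {x} →
             x ∈ᴵ narrow v c I → x ∈ᴵ I
  narrow-⊆ v (tri< _ _ _) I (l , u) = l , ≺-trans u (proj₂ (pivot-∈ v I))
  narrow-⊆ v (tri≈ _ _ _) I (l , u) = ≺-trans (proj₁ (pivot-∈ v I)) l , u
  narrow-⊆ v (tri> _ _ _) I (l , u) = ≺-trans (proj₁ (pivot-∈ v I)) l , u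

  -- Points on the same side of `p` keep a common interval; otherwise the pivot lies between their
  -- intervals.
  narrow-separates : ∀ {q q′ p} v (c : Tri (q < p) (q ≈A p) (p < q))
    (c′ : Tri (q′ < p) (q′ ≈A p) (p < q′)) I → q < q′ →
    narrow v c I ≡ narrow v c′ I ⊎ Separated (narrow v c I) (narrow v c′ I)
  narrow-separates v (tri< _ _ _) (tri< _ _ _) I q<q′ = inj₁ refl
  narrow-separates v (tri< _ _ _) (tri≈ _ _ _) I q<q′ = inj₂ λ (_ , x≺z) (z≺y , _) → ≺-trans x≺z z≺y
  narrow-separates v (tri< _ _ _) (tri> _ _ _) I q<q′ = inj₂ λ (_ , x≺z) (z≺y , _) → ≺-trans x≺z z≺y
  narrow-separates v (tri≈ _ q≈p _) (tri< q′<p _ _) I q<q′ = ⊥-elim (irrefl q≈p (<-trans q<q′ q′<p))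
  narrow-separates v (tri≈ _ _ _) (tri≈ _ _ _) I q<q′ = inj₁ refl
  narrow-separates v (tri≈ _ _ _) (tri> _ _ _) I q<q′ = inj₁ refl
  narrow-separates v (tri> q≮p _ _) (tri< q′<p _ _) I q<q′ = ⊥-elim (q≮p (<-trans q<q′ q′<p))
  narrow-separates v (tri> _ _ _) (tri≈ _ _ _) I q<q′ = inj₁ refl
  narrow-separates v (tri> _ _ _) (tri> _ _ _) I q<q′ = inj₁ refl

  mutual
    bounds : ℕ → C → Interval
    bounds zero    q = lo , hi , lo-R-hi
    bounds (suc n) q = narrow (last n) (compare q (e n)) (bounds n q)

    last : ℕ → X
    last zero    = lo
    last (suc n) = pivot (last n) (bounds n (e n))

  image : ℕ → X
  image n = last (suc n)

  bounds-⊆ : ∀ {m n} → m ℕ.≤′ n → ∀ q {x} → x ∈ᴵ bounds n q → x ∈ᴵ bounds m q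
  bounds-⊆ ℕ.≤′-refl           q i = i
  bounds-⊆ (ℕ.≤′-step {n} m≤n) q i =
    bounds-⊆ m≤n q (narrow-⊆ (last n) (compare q (e n)) (bounds n q) i)

  image-∈ : ∀ {m n} → m ℕ.≤ n → image n ∈ᴵ bounds m (e n)
  image-∈ {n = n} m≤n =
    bounds-⊆ (ℕ.≤⇒≤′ m≤n) (e n) (pivot-∈ (last n) (bounds n (e n)))

  bounds-separate : ∀ {q q′} → q < q′ → ∀ n →
    bounds n q ≡ bounds n q′ ⊎ Separated (bounds n q) (bounds n q′)
  bounds-separate q<q′ zero = inj₁ refl
  bounds-separate {q} {q′} q<q′ (suc n) with bounds-separate q<q′ n
  ... | inj₁ eq rewrite eq =
        narrow-separates (last n) (compare q (e n)) (compare q′ (e n)) (bounds n q′) q<q′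
  ... | inj₂ sep = inj₂ λ i j → sep
        (narrow-⊆ (last n) (compare q (e n)) (bounds n q) i)
        (narrow-⊆ (last n) (compare q′ (e n)) (bounds n q′) j)

  -- At the stage of the earlier index the two intervals are separated or equal. If equal, the
  -- earlier image is the pivot, and `narrow` puts the later point on the correct side of it.
  image-mono : ∀ {i j} → e i < e j → image i ≺ image j
  image-mono {i} {j} ei<ej with ℕ.<-cmp i j
  ... | tri≈ _ refl _ = ⊥-elim (irrefl ≈A.refl ei<ej)
  ... | tri< i<j _ _ with bounds-separate ei<ej i
  ...   | inj₂ sep = sep (image-∈ {i} ℕ.≤-refl) (image-∈ (ℕ.<⇒≤ i<j))
  ...   | inj₁ eq rewrite eq with compare (e j) (e i) | image-∈ {suc i} i<j
  ...     | tri< ej<ei _ _ | _       = ⊥-elim (irrefl ≈A.refl (<-trans ei<ej ej<ei))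
  ...     | tri≈ _ _ _     | z≺j , _ = z≺j
  ...     | tri> _ _ _     | z≺j , _ = z≺j
  image-mono {i} {j} ei<ej | tri> _ _ j<i with bounds-separate ei<ej j
  ...   | inj₂ sep = sep (image-∈ (ℕ.<⇒≤ j<i)) (image-∈ {j} ℕ.≤-refl)
  ...   | inj₁ eq rewrite sym eq with compare (e i) (e j) | image-∈ {suc j} j<i
  ...     | tri< _ _ _     | _ , i≺z = i≺z
  ...     | tri≈ _ ei≈ej _ | _       = ⊥-elim (irrefl ei≈ej ei<ej)
  ...     | tri> _ _ ej<ei | _       = ⊥-elim (irrefl ≈A.refl (<-trans ei<ej ej<ei))

  image-V-mono : ∀ {i j} → i ℕ.< j → V (image i) (image j)
  image-V-mono {i} i<j = go (ℕ.≤⇒≤′ i<j)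
    where
    go : ∀ {j} → suc i ℕ.≤′ j → V (image i) (image j)
    go ℕ.≤′-refl         = V-pivot _ _
    go (ℕ.≤′-step i<j) = V-trans (go i<j) (V-pivot _ _)

-- The order of Ω(η) in terms of lexicographic order and length

lex-≤⇒≡⊎< : ∀ {s t} → Lex-≤ _≡_ Bool._<_ s t → s ≡ t ⊎ s <ᴸ t
lex-≤⇒≡⊎< (base _) = inj₁ refl
lex-≤⇒≡⊎< halt     = inj₂ halt
lex-≤⇒≡⊎< (this l) = inj₂ (this l)
lex-≤⇒≡⊎< (next refl l) with lex-≤⇒≡⊎< l
... | inj₁ refl = inj₁ refl
... | inj₂ l′   = inj₂ (next refl l′)

prefix⇒≡⊎< : ∀ {s t : List Bool} → Prefix _≡_ s t → s ≡ t ⊎ s <ᴸ t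
prefix⇒≡⊎< {t = []}    [] = inj₁ refl
prefix⇒≡⊎< {t = _ ∷ _} [] = inj₂ halt
prefix⇒≡⊎< (refl ∷ p) with prefix⇒≡⊎< p
... | inj₁ refl = inj₁ refl
... | inj₂ l    = inj₂ (next refl l)

≤Ω⇒≡⊎< : ∀ {s t} → s ≤Ω t → s ≡ t ⊎ s <ᴸ t
≤Ω⇒≡⊎< ε = inj₁ refl
≤Ω⇒≡⊎< (x ◅ xs) with step x | ≤Ω⇒≡⊎< xs
  where
  step : ∀ {s t} → Prefix _≡_ s t ⊎ SameLevelLex s t → s ≡ t ⊎ s <ᴸ t
  step (inj₁ p)       = prefix⇒≡⊎< p
  step (inj₂ (_ , l)) = lex-≤⇒≡⊎< l
... | inj₁ refl | l         = l
... | inj₂ l    | inj₁ refl = inj₂ l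
... | inj₂ l    | inj₂ l′   = inj₂ (ᴸ.trans l l′)

-- `u` is `t` cut off at the length of `s`, which keeps the first difference between them.
<⇒≤-prefix : ∀ {s t} → s <ᴸ t → length s ℕ.≤ length t →
  ∃[ u ] length s ≡ length u × Lex-≤ _≡_ Bool._<_ s u × Prefix _≡_ u t
<⇒≤-prefix halt _ = [] , refl , base _ , []
<⇒≤-prefix {_ ∷ s} {y ∷ t} (this l) (s≤s n) =
  let u , e , p = truncate s t n in y ∷ u , cong suc e , this l , refl ∷ p
  where
  truncate : ∀ (s t : List Bool) → length s ℕ.≤ length t →
             ∃[ u ] length s ≡ length u × Prefix _≡_ u t
  truncate []      t       _       = [] , refl , []
  truncate (_ ∷ s) (y ∷ t) (s≤s n) = let u , e , p = truncate s t n in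
    y ∷ u , cong suc e , refl ∷ p
<⇒≤-prefix {x ∷ _} (next refl l) (s≤s n) = let u , e , l′ , p = <⇒≤-prefix l n in
  x ∷ u , cong suc e , next refl l′ , refl ∷ p

-- With `≤Ω⇒≡⊎<` and `≤Ω-length` this makes `_≤Ω_` the intersection of the lexicographic order with
-- the comparison of lengths.
<∧length≤⇒≤Ω : ∀ {s t} → s <ᴸ t → length s ℕ.≤ length t → s ≤Ω t
<∧length≤⇒≤Ω l n = let _ , e , l′ , p = <⇒≤-prefix l n in
  inj₂ (e , l′) ◅ inj₁ p ◅ ε

<ᴸ⇒≰Ω : ∀ {s t} → s <ᴸ t → ¬ (t ≤Ω s)
<ᴸ⇒≰Ω {s} {t} l t≤s with ≤Ω⇒≡⊎< t≤s
... | inj₁ refl = ᴸ.irrefl {s} ᴸ.Eq.refl l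
... | inj₂ l′   = ᴸ.asym l l′

length<⇒≰Ω : ∀ {s t} → length s ℕ.< length t → ¬ (t ≤Ω s)
length<⇒≰Ω l t≤s = ℕ.<⇒≱ l (≤Ω-length t≤s)

replicate-false-≤Ω : ∀ n {t} → n ℕ.≤ length t → replicate n false ≤Ω t
replicate-false-≤Ω n {t} n≤t with <-or-≡ n t n≤t
  where
  <-or-≡ : ∀ n t → n ℕ.≤ length t → replicate n false ≡ t ⊎ replicate n false <ᴸ t
  <-or-≡ zero    []          _ = inj₁ refl
  <-or-≡ zero    (_ ∷ _)     _ = inj₂ halt
  <-or-≡ (suc n) (true ∷ t)  _ = inj₂ (this f<t)
  <-or-≡ (suc n) (false ∷ t) (s≤s l) with <-or-≡ n t l
  ... | inj₁ refl = inj₁ refl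
  ... | inj₂ l′   = inj₂ (next refl l′)
... | inj₁ refl = ε
... | inj₂ l    = <∧length≤⇒≤Ω l (subst (ℕ._≤ length t) (sym (length-replicate n)) n≤t)

≤Ω-replicate-true : ∀ t → t ≤Ω replicate (length t) true
≤Ω-replicate-true t = inj₂ (sym (length-replicate (length t)) , lex t) ◅ ε
  where
  lex : ∀ t → Lex-≤ _≡_ Bool._<_ t (replicate (length t) true)
  lex []          = base _
  lex (false ∷ t) = this f<t
  lex (true ∷ t)  = next refl (lex t)

-- Strict parts of linear orders, and copies of ℚ in them

module Strictly {P : Poset a ℓ₁ ℓ₂} (L : LinearOrderOn P) where
  open LinearOrderOn L using (_≤_; isTotalOrder)
  module O = IsTotalOrder isTotalOrder

  infix 4 _≺_

  -- By totality this is the strict part of `_≤_`, in a form that does not mention `≈`.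
  _≺_ : Rel (Poset.Carrier P) ℓ₂
  x ≺ y = ¬ (y ≤ x)

  ≺⇒≤ : ∀ {x y} → x ≺ y → x ≤ y
  ≺⇒≤ {x} {y} x≺y with O.total x y
  ... | inj₁ x≤y = x≤y
  ... | inj₂ y≤x = contradiction y≤x x≺y

  ≺-trans : Transitive _≺_
  ≺-trans x≺y y≺z z≤x = x≺y (O.trans (≺⇒≤ y≺z) z≤x)

ℚ-poset : Poset 0ℓ 0ℓ 0ℓ
ℚ-poset = DecTotalOrder.poset ℚ.≤-decTotalOrder

module _ (em : ExcludedMiddle 0ℓ) {P : Poset a ℓ₁ ℓ₂} (L : LinearOrderOn P) where
  open LinearOrderOn L using (_≤_; poset)
  open Strictly L

  -- `R` stands for a dense relation finer than the strict order; it is later `Diverge` or `_≪_`.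
  dense⇒ℚ-embeddable : {X : Set x} (f : X → Poset.Carrier P) {R : Rel X r} →
    (∀ {x y} → R x y → f x ≺ f y) →
    (∀ {x y} → R x y → ∃[ z ] R x z × R z y) →
    ∀ {x y} → R x y → Embeddable ℚ-poset poset
  dense⇒ℚ-embeddable {X = X} f {R} R⇒≺ dense xRy = embeddable ℚ-poset poset (g , mono , cancel)
    where
    _≺ᶠ_ : Rel X _
    x ≺ᶠ y = f x ≺ f y

    Trivial : Rel X 0ℓ
    Trivial _ _ = ⊤

    between : ∀ v {x y} → R x y → ∃[ z ] R x z × R z y × Trivial v z
    between _ xRy = let z , xRz , zRy = dense xRy in z , xRz , zRy , tt

    open Enumeration em
    open Interpolation ℚ.<-strictTotalOrder enumℚ {_≺_ = _≺ᶠ_} ≺-trans R⇒≺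
      {V = Trivial} _ between xRy

    g : ℚ → Poset.Carrier P
    g q = f (image (indexℚ q))

    g-mono : ∀ {p q} → p ℚ.< q → g p ≺ g q
    g-mono {p} {q} p<q =
      image-mono (subst₂ ℚ._<_ (sym (enumℚ-indexℚ p)) (sym (enumℚ-indexℚ q)) p<q)

    mono : ∀ {p q} → p ℚ.≤ q → g p ≤ g q
    mono {p} {q} p≤q with ℚ.<-cmp p q
    ... | tri< p<q _ _  = ≺⇒≤ (g-mono p<q)
    ... | tri≈ _ refl _ = O.refl
    ... | tri> _ _ q<p  = ⊥-elim (ℚ.<-irrefl refl (ℚ.<-≤-trans q<p p≤q))

    cancel : ∀ {p q} → g p ≤ g q → p ℚ.≤ q
    cancel gp≤gq = ℚ.≮⇒≥ λ q<p → g-mono q<p gp≤gq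

-- Duality

dualOrder : {P : Poset a ℓ₁ ℓ₂} → LinearOrderOn P → LinearOrderOn (Dual P)
dualOrder L = record { isTotalOrder = Flip.isTotalOrder (LinearOrderOn.isTotalOrder L) }

dualIntersection : {P : Poset a ℓ₁ ℓ₂} (L₁ L₂ : LinearOrderOn P) →
  IsIntersectionOf P L₁ L₂ → IsIntersectionOf (Dual P) (dualOrder L₁) (dualOrder L₂)
dualIntersection L₁ L₂ (to , from) = to , from

-- Negation is an isomorphism of ℚ with its dual.
dualScattered : {P : Poset a ℓ₁ ℓ₂} (L : LinearOrderOn P) →
  Scattered (LinearOrderOn.poset L) → Scattered (LinearOrderOn.poset (dualOrder L))
dualScattered L scattered e with orderEmbedding ℚ-poset (LinearOrderOn.poset (dualOrder L)) e
... | f , mono , cancel = scattered (embeddable ℚ-poset (LinearOrderOn.poset L)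
  (f ∘ ℚ.-_ , mono ∘ ℚ.neg-antimono-≤ , λ {p} {q} l →
    subst₂ ℚ._≤_ (ℚ⁺.⁻¹-involutive p) (ℚ⁺.⁻¹-involutive q) (ℚ.neg-antimono-≤ (cancel l))))

module _ (P : Poset a ℓ₁ ℓ₂) (Q : Poset b ℓ₃ ℓ₄) where

  dual-embeddable : Embeddable P (Dual Q) → Embeddable (Dual P) Q
  dual-embeddable e with orderEmbedding P (Dual Q) e
  ... | f , mono , cancel = embeddable (Dual P) Q (f , mono , cancel)

  embeddable-dual : Embeddable (Dual P) Q → Embeddable P (Dual Q)
  embeddable-dual e with orderEmbedding (Dual P) Q e
  ... | f , mono , cancel = embeddable P (Dual Q) (f , mono , cancel)

-- Ω(η) in an intersection of two linear orders

-- Between two lists related by Diverge there is room for a third: this is the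
-- strict order of the dyadic numbers 0.s, lists of equal value being unrelated.
data Diverge : Rel (List Bool) 0ℓ where
  []-true  : ∀ {t} → Diverge [] (true ∷ t)
  []-false : ∀ {t} → Diverge [] t → Diverge [] (false ∷ t)
  split    : ∀ {s t} → Diverge (false ∷ s) (true ∷ t)
  under    : ∀ {x s t} → Diverge s t → Diverge (x ∷ s) (x ∷ t)

diverge⇒< : ∀ {s t} → Diverge s t → s <ᴸ t
diverge⇒< []-true      = halt
diverge⇒< ([]-false _) = halt
diverge⇒< split        = this f<t
diverge⇒< (under d)    = next refl (diverge⇒< d)

diverge-dense : ∀ {s t} → Diverge s t → ∃[ u ] Diverge s u × Diverge u t
diverge-dense []-true          = false ∷ true ∷ [] , []-false []-true , split
diverge-dense ([]-false d)     = let u , l , r = diverge-dense d in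
  false ∷ u , []-false l , under r
-- A final 1 raises the value of 0.0s but keeps it below 0.1.
diverge-dense (split {s = s})  = false ∷ s ++ true ∷ [] , under (append s) , split
  where
  append : ∀ s → Diverge s (s ++ true ∷ [])
  append []      = []-true
  append (_ ∷ s) = under (append s)
diverge-dense (under {x = x} d) = let u , l , r = diverge-dense d in
  x ∷ u , under l , under r

module _ {P : Poset a ℓ₁ ℓ₂} (L₁ L₂ : LinearOrderOn P)
         (P≐L₁∩L₂ : IsIntersectionOf P L₁ L₂) where
  private
    module P = Poset P
    module L₁ = LinearOrderOn L₁
    module L₂ = LinearOrderOn L₂
    module O₁ = IsTotalOrder L₁.isTotalOrder
    module O₂ = IsTotalOrder L₂.isTotalOrder

  intersection-nonseparating : ¬ Separating P L₁
  intersection-nonseparating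
    (x , y , z , (x≤z , _) , (y≰x , x≰y) , (y≰z , z≰y) , (x≤₁y , _) , (y≤₁z , _))
    with O₂.total x y | O₂.total y z
  ... | inj₁ x≤₂y | _         = x≰y (proj₂ P≐L₁∩L₂ (x≤₁y , x≤₂y))
  ... | inj₂ _    | inj₁ y≤₂z = y≰z (proj₂ P≐L₁∩L₂ (y≤₁z , y≤₂z))
  ... | inj₂ y≤₂x | inj₂ _    =
    y≰z (proj₂ P≐L₁∩L₂ (y≤₁z , O₂.trans y≤₂x (proj₂ (proj₁ P≐L₁∩L₂ x≤z))))

  -- If `x` preceded `y′` in `L₁`, then `y′` would precede `x` in `L₂`, and `y` would lie below `x`
  -- in both orders. With `force-down` this carries the `L₁`-order of one pair to another.
  force-up : ∀ {x y y′} → y L₁.≤ x → ¬ (y P.≤ x) → ¬ (x P.≤ y′) → y P.≤ y′ → y′ L₁.≤ x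
  force-up {x} {y} {y′} y≤₁x y≰x x≰y′ y≤y′ with O₁.total y′ x | O₂.total x y′
  ... | inj₁ y′≤₁x | _          = y′≤₁x
  ... | inj₂ x≤₁y′ | inj₁ x≤₂y′ = contradiction (proj₂ P≐L₁∩L₂ (x≤₁y′ , x≤₂y′)) x≰y′
  ... | inj₂ _     | inj₂ y′≤₂x = contradiction
    (proj₂ P≐L₁∩L₂ (y≤₁x , O₂.trans (proj₂ (proj₁ P≐L₁∩L₂ y≤y′)) y′≤₂x)) y≰x

  force-down : ∀ {x x′ y} → y L₁.≤ x → ¬ (y P.≤ x) → ¬ (x′ P.≤ y) → x′ P.≤ x → y L₁.≤ x′
  force-down {x} {x′} {y} y≤₁x y≰x x′≰y x′≤x with O₁.total y x′ | O₂.total x′ y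
  ... | inj₁ y≤₁x′ | _          = y≤₁x′
  ... | inj₂ x′≤₁y | inj₁ x′≤₂y = contradiction (proj₂ P≐L₁∩L₂ (x′≤₁y , x′≤₂y)) x′≰y
  ... | inj₂ _     | inj₂ y≤₂x′ = contradiction
    (proj₂ P≐L₁∩L₂ (y≤₁x , O₂.trans y≤₂x′ (proj₂ (proj₁ P≐L₁∩L₂ x′≤x)))) y≰x

  -- The L₁-order of the incomparable pair [0,0], [1] determines that of every other.
  Ωη-forces-lex : ((f , _) : OrderEmbedding Ωη P) →
    f (false ∷ false ∷ []) L₁.≤ f (true ∷ []) → ∀ {s t} → s <ᴸ t → f s L₁.≤ f t
  Ωη-forces-lex (f , mono , cancel) y₀≤x₀ {s} {t} s<t with length s ℕ.≤? length t
  ... | yes s≤t = proj₁ (proj₁ P≐L₁∩L₂ (mono (<∧length≤⇒≤Ω s<t s≤t)))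
  ... | no s≰t = s≤₁t (nonempty s<t) (ℕ.≰⇒> s≰t)
    where
    nonempty : ∀ {s t} → s <ᴸ t → 1 ℕ.≤ length t
    nonempty halt       = s≤s z≤n
    nonempty (this _)   = s≤s z≤n
    nonempty (next _ _) = s≤s z≤n

    s≤₁t : 1 ℕ.≤ length t → length t ℕ.< length s → f s L₁.≤ f t
    s≤₁t 1≤t t<s =
      force-up z≤₁t z≰t (λ t≤s → <ᴸ⇒≰Ω s<t (cancel t≤s)) (mono z≤s)
      where
      m = length s
      -- `z` is leftmost on the level of `s`, `j` rightmost on that of `t`. From [0,0] before [1]
      -- follow in turn `z` before [1], `z` before `j`, `z` before `t` and `s` before `t`.
      z = replicate m false
      j = replicate (length t) true

      |z| : length z ≡ m
      |z| = length-replicate m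

      |j| : length j ≡ length t
      |j| = length-replicate (length t)

      z≤s : z ≤Ω s
      z≤s = replicate-false-≤Ω m ℕ.≤-refl

      z<x₀ : ∀ {n} → 1 ℕ.≤ n → replicate n false <ᴸ (true ∷ [])
      z<x₀ (s≤s _) = this f<t

      z≰ : ∀ {u} → length u ℕ.≤ length t → ¬ (f z P.≤ f u)
      z≰ u≤t z≤u = length<⇒≰Ω
        (subst (_ ℕ.<_) (sym |z|) (ℕ.≤-<-trans u≤t t<s)) (cancel z≤u)

      z≰t : ¬ (f z P.≤ f t)
      z≰t = z≰ ℕ.≤-refl

      z≤₁x₀ : f z L₁.≤ f (true ∷ [])
      z≤₁x₀ = force-up y₀≤x₀ (λ le → length<⇒≰Ω (ℕ.≤-refl) (cancel le))
        (λ le → <ᴸ⇒≰Ω (z<x₀ (ℕ.≤-trans 1≤t (ℕ.<⇒≤ t<s))) (cancel le))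
        (mono (replicate-false-≤Ω 2 (subst (2 ℕ.≤_) (sym |z|) (ℕ.≤-<-trans 1≤t t<s))))

      x₀≤j : ∀ {n} → 1 ℕ.≤ n → (true ∷ []) ≤Ω replicate n true
      x₀≤j (s≤s _) = inj₁ (refl ∷ []) ◅ ε

      z≤₁t : f z L₁.≤ f t
      z≤₁t = force-down (O₁.trans z≤₁x₀ (proj₁ (proj₁ P≐L₁∩L₂ (mono (x₀≤j 1≤t)))))
        (z≰ (ℕ.≤-reflexive |j|))
        (λ t≤z → <ᴸ⇒≰Ω s<t (Poset.trans Ωη (cancel t≤z) z≤s))
        (mono (≤Ω-replicate-true t))

  Ωη-forced⇒¬scattered : ExcludedMiddle 0ℓ → ((f , _) : OrderEmbedding Ωη P) →
    f (false ∷ false ∷ []) L₁.≤ f (true ∷ []) → ¬ Scattered L₁.poset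
  Ωη-forced⇒¬scattered em ι@(f , mono , cancel) y₀≤x₀ scattered =
    scattered (dense⇒ℚ-embeddable em L₁ f {R = Diverge}
      (λ d → strict (diverge⇒< d)) diverge-dense ([]-true {[]}))
    where
    strict : ∀ {s t} → s <ᴸ t → ¬ (f t L₁.≤ f s)
    strict l ft≤fs = <ᴸ⇒≰Ω l (cancel (P.reflexive
      (O₁.antisym ft≤fs (Ωη-forces-lex ι y₀≤x₀ l))))

module _ (em : ExcludedMiddle 0ℓ) {P : Poset a ℓ₁ ℓ₂} (L₁ L₂ : LinearOrderOn P)
         (P≐L₁∩L₂ : IsIntersectionOf P L₁ L₂) where
  private
    module L₁ = LinearOrderOn L₁
    module L₂ = LinearOrderOn L₂

  -- The two orders cannot both put [1] before [0,0], as [1] would then lie below [0,0] in Ω(η). One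
  -- that puts [0,0] first is not scattered.
  scattered-intersection⇒¬Ωη : Scattered L₁.poset → Scattered L₂.poset → ¬ Embeddable Ωη P
  scattered-intersection⇒¬Ωη sc₁ sc₂ Ω↪P with orderEmbedding Ωη P Ω↪P
  ... | ι@(f , mono , cancel)
    with IsTotalOrder.total L₁.isTotalOrder (f (false ∷ false ∷ [])) (f (true ∷ []))
       | IsTotalOrder.total L₂.isTotalOrder (f (false ∷ false ∷ [])) (f (true ∷ []))
  ...   | inj₁ y≤₁x | _         = Ωη-forced⇒¬scattered L₁ L₂ P≐L₁∩L₂ em ι y≤₁x sc₁
  ...   | inj₂ _    | inj₁ y≤₂x = Ωη-forced⇒¬scattered L₂ L₁
    ((λ le → let p , q = proj₁ P≐L₁∩L₂ le in q , p) , λ (p , q) → proj₂ P≐L₁∩L₂ (q , p))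
    em ι y≤₂x sc₂
  ...   | inj₂ x≤₁y | inj₂ x≤₂y =
    <ᴸ⇒≰Ω {s = false ∷ false ∷ []} (this f<t) (cancel (proj₂ P≐L₁∩L₂ (x≤₁y , x≤₂y)))

-- Building Ω(η) from a dense set with cofinal intervals

module _ (em : ExcludedMiddle 0ℓ) {P : Poset a ℓ₁ ℓ₂} (L₁ L₂ : LinearOrderOn P)
         (P≐L₁∩L₂ : IsIntersectionOf P L₁ L₂) where
  private
    module P = Poset P
    module L₁ = LinearOrderOn L₁
    module L₂ = LinearOrderOn L₂
    module O₁ = IsTotalOrder L₁.isTotalOrder
    module O₂ = IsTotalOrder L₂.isTotalOrder
  open Strictly L₂

  -- `L₂` realizes the lexicographic order and `L₁` the shortlex order, whose intersection is the
  -- order of Ω(η).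
  cofinally-dense⇒Ωη-embeddable : {S : Pred P.Carrier ℓ} →
    (∀ v → S v → ∀ {x y} → S x → S y → x ≺ y → ∃[ z ] S z × x ≺ z × z ≺ y × v L₁.≤ z) →
    ∀ {x y} → S x → S y → x ≺ y → Embeddable Ωη P
  cofinally-dense⇒Ωη-embeddable {S = S} cofinal Sx Sy x≺y =
    embeddable Ωη P (f , mono , cancel)
    where
    _≺ˢ_ _≤ˢ_ : Rel (∃ S) _
    (x , _) ≺ˢ (y , _) = x ≺ y
    (x , _) ≤ˢ (y , _) = x L₁.≤ y

    between : ∀ v {x y} → x ≺ˢ y → ∃[ z ] x ≺ˢ z × z ≺ˢ y × v ≤ˢ z
    between (v , Sv) {_ , Sx} {_ , Sy} x≺y =
      let z , Sz , xz , zy , v≤z = cofinal v Sv Sx Sy x≺y in (z , Sz) , xz , zy , v≤z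

    open Enumeration em
    open Interpolation lexOrder enum {X = ∃ S} {_≺_ = _≺ˢ_} ≺-trans {R = _≺ˢ_} id
      {V = _≤ˢ_} O₁.trans between {_ , Sx} {_ , Sy} x≺y

    f : List Bool → P.Carrier
    f s = proj₁ (image (index s))

    f-lex-mono : ∀ {s t} → s <ᴸ t → f s ≺ f t
    f-lex-mono {s} {t} l =
      image-mono (subst₂ _<ᴸ_ (sym (enum-index s)) (sym (enum-index t)) l)

    mono : ∀ {s t} → s ≤Ω t → f s P.≤ f t
    mono {s} {t} s≤t with ≤Ω⇒≡⊎< s≤t
    ... | inj₁ refl = P.refl
    ... | inj₂ l    = proj₂ P≐L₁∩L₂ (image-V-mono (index-mono (ℕ.m≤n⇒m<n∨m≡n (≤Ω-length s≤t))) ,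
                                     ≺⇒≤ (f-lex-mono l))
      where
      index-mono : length s ℕ.< length t ⊎ length s ≡ length t → index s ℕ.< index t
      index-mono (inj₁ n) = index-length-mono {s} {t} n
      index-mono (inj₂ n) = index-lex-mono n l

    cancel : ∀ {s t} → f s P.≤ f t → s ≤Ω t
    cancel {s} {t} fs≤ft with ᴸ.compare s t | length s ℕ.≤? length t
    ... | tri> _ _ t<s | _ = contradiction (proj₂ (proj₁ P≐L₁∩L₂ fs≤ft)) (f-lex-mono t<s)
    ... | tri≈ _ s≋t _ | _ rewrite Pointwise-≡⇒≡ s≋t = ε
    ... | tri< s<t _ _ | yes s≤t = <∧length≤⇒≤Ω s<t s≤t
    -- `image-V-mono` is not strict; equality in `L₁` is excluded by the strict `L₂`-order.
    ... | tri< s<t _ _ | no s≰t  = contradiction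
      (O₂.reflexive (O₁.antisym
        (image-V-mono (index-length-mono {t} {s} (ℕ.≰⇒> s≰t)))
        (proj₁ (proj₁ P≐L₁∩L₂ fs≤ft))))
      (f-lex-mono s<t)

-- Large sets and the relation `_≪_`

module Large {c ℓ₁ ℓ₂} (em : ExcludedMiddle (c ⊔ ℓ₂)) {P : Poset c ℓ₁ ℓ₂}
             (L₁ L₂ : LinearOrderOn P) where
  open Poset P using (Carrier)
  open Strictly L₂
  private
    module L₁ = LinearOrderOn L₁
    module L₂ = LinearOrderOn L₂
    module O₁ = IsTotalOrder L₁.isTotalOrder

  Dense : Pred Carrier ℓ → Set (c ⊔ ℓ₂ ⊔ ℓ)
  Dense S =
    (∃₂ λ x y → S x × S y × x ≺ y) ×
    (∀ {x y} → S x → S y → x ≺ y → ∃[ z ] S z × x ≺ z × z ≺ y)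

  -- The dense subset is Boolean-valued so that largeness does not raise the
  -- universe level above that of the excluded middle at hand.
  IsLarge : Pred Carrier ℓ → Set (c ⊔ ℓ₂ ⊔ ℓ)
  IsLarge A = Σ[ b ∈ (Carrier → Bool) ] (T ∘ b) ⊆ A × Dense (T ∘ b)

  dense⇒large : {S : Pred Carrier ℓ} → (∀ x → Dec (S x)) → Dense S → IsLarge S
  dense⇒large S? ((x , y , Sx , Sy , x≺y) , dense) =
    (λ x → ⌊ S? x ⌋) , (λ {x} → toWitness {a? = S? x}) ,
    (x , y , fromWitness Sx , fromWitness Sy , x≺y) ,
    λ {x} {y} Sx Sy x≺y →
      let z , Sz , l , u = dense (toWitness {a? = S? x} Sx) (toWitness {a? = S? y} Sy) x≺y
      in z , fromWitness Sz , l , u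

  large-⊆ : {A : Pred Carrier ℓ} {B : Pred Carrier ℓ′} → A ⊆ B → IsLarge A → IsLarge B
  large-⊆ A⊆B (b , b⊆A , dense) = b , (λ Tb → A⊆B (b⊆A Tb)) , dense

  between-large : {S : Pred Carrier 0ℓ} → (∀ x → Dec (S x)) → Dense S →
    ∀ {x y} → S x → S y → x ≺ y → IsLarge (λ z → S z × x ≺ z × z ≺ y)
  between-large S? (_ , dense) {x} {y} Sx Sy x≺y =
    let z  , Sz  , xz  , zy  = dense Sx Sy x≺y
        z′ , Sz′ , xz′ , z′z = dense Sx Sz xz
    in dense⇒large (λ z → S? z ×-dec (lowerEM c em ×-dec lowerEM c em))
      ( (z′ , z , (Sz′ , xz′ , ≺-trans z′z zy) , (Sz , xz , zy) , z′z)
      , λ (Sp , xp , _) (Sq , _ , qy) p≺q →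
          let w , Sw , pw , wq = dense Sp Sq p≺q
          in w , (Sw , ≺-trans xp pw , ≺-trans wq qy) , pw , wq)

  -- Either some `L₂`-interval of the dense subset misses `B` and is itself dense, or `B` meets
  -- every such interval, so that its points in `b` are dense.
  large-split : {A : Pred Carrier ℓ} → IsLarge A → (B : Pred Carrier (c ⊔ ℓ₂)) →
    IsLarge (A ∩ B) ⊎ IsLarge (A ∩ ∁ B)
  large-split (b , b⊆A , dense) B
    with em {∃₂ λ x y → T (b x) × T (b y) × x ≺ y ×
             (∀ {z} → T (b z) → x ≺ z → z ≺ y → ¬ B z)}
  ... | yes (x , y , bx , by , x≺y , none) = inj₂ (large-⊆
          (λ (bz , xz , zy) → b⊆A bz , none bz xz zy)
          (between-large (T? ∘ b) dense bx by x≺y))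
  ... | no somewhere-none = inj₁ (large-⊆ (λ (bz , Bz) → b⊆A bz , Bz)
          (dense⇒large (λ z → T? (b z) ×-dec em)
            ( two-points
            , λ (bx , _) (by , _) x≺y →
                let z , bz , Bz , xz , zy = B-between bx by x≺y in z , (bz , Bz) , xz , zy)))
    where
    B-between : ∀ {x y} → T (b x) → T (b y) → x ≺ y →
                ∃[ z ] T (b z) × B z × x ≺ z × z ≺ y
    B-between bx by x≺y = decidable-stable em λ none → somewhere-none
      (_ , _ , bx , by , x≺y , λ bz xz zy Bz → none (_ , bz , Bz , xz , zy))

    two-points : ∃₂ λ x y → (T (b x) × B x) × (T (b y) × B y) × x ≺ y
    two-points =
      let x , y , bx , by , x≺y = proj₁ dense
          z , bz , Bz , xz , _  = B-between bx by x≺y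
          w , bw , Bw , _ , wz  = B-between bx bz xz
      in w , z , (bw , Bw) , (bz , Bz) , wz

  [_,_⟩ : Carrier → Carrier → Pred Carrier ℓ₂
  [ x , y ⟩ z = x L₁.≤ z × ¬ (y L₁.≤ z)

  _≪_ : Rel Carrier (c ⊔ ℓ₂)
  x ≪ y = IsLarge [ x , y ⟩

  ≪⇒≱ : ∀ {x y} → x ≪ y → ¬ (y L₁.≤ x)
  ≪⇒≱ (_ , b⊆ , (w , _ , bw , _) , _) y≤x =
    let x≤w , y≰w = b⊆ bw in y≰w (O₁.trans y≤x x≤w)

  module _ (P≐L₁∩L₂ : IsIntersectionOf P L₁ L₂) where

    -- Each `L₂`-interval of `b` is large. If all its points were `L₁`-below some `v` in `b`, then
    -- `x ≪ v`. So under `none` it reaches up to every `v`, which embeds Ω(η).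
    ≪-cofinal : ¬ Embeddable Ωη P → {A : Pred Carrier ℓ} → IsLarge A →
      ∀ {x} → A ⊆ (x L₁.≤_) → ¬ (∀ {y} → A y → ¬ (x ≪ y))
    ≪-cofinal ¬Ω (b , b⊆A , dense@((p , q , bp , bq , p≺q) , _)) A⊆ none =
      ¬Ω (cofinally-dense⇒Ωη-embeddable (lowerEM _ em) L₁ L₂ P≐L₁∩L₂ cofinal bp bq p≺q)
      where
      cofinal : ∀ v → T (b v) → ∀ {x y} → T (b x) → T (b y) → x ≺ y →
                ∃[ z ] T (b z) × x ≺ z × z ≺ y × v L₁.≤ z
      cofinal v bv bx by x≺y = decidable-stable em λ ∄z → none (b⊆A bv)
        (large-⊆ (λ (bz , xz , zy) → A⊆ (b⊆A bz) , λ v≤z → ∄z (_ , bz , xz , zy , v≤z))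
          (between-large (T? ∘ b) dense bx by x≺y))

    -- The same argument with both orders reversed, which puts Ω(η) into the dual of `P`.
    ≪-coinitial : ¬ Embeddable (Dual Ωη) P → {A : Pred Carrier ℓ} → IsLarge A →
      ∀ {y} → (∀ {z} → A z → ¬ (y L₁.≤ z)) → ¬ (∀ {z} → A z → ¬ (z ≪ y))
    ≪-coinitial ¬Ω* (b , b⊆A , dense@((p , q , bp , bq , p≺q) , _)) A⊆ none =
      ¬Ω* (dual-embeddable Ωη P (cofinally-dense⇒Ωη-embeddable (lowerEM _ em)
        (dualOrder L₁) (dualOrder L₂) (dualIntersection L₁ L₂ P≐L₁∩L₂)
        coinitial bq bp p≺q))
      where
      coinitial : ∀ v → T (b v) → ∀ {x y} → T (b x) → T (b y) → y ≺ x →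
                  ∃[ z ] T (b z) × z ≺ x × y ≺ z × z L₁.≤ v
      coinitial v bv bx by y≺x = decidable-stable em λ ∄z → none (b⊆A bv)
        (large-⊆ (λ (bz , yz , zx) →
            Strictly.≺⇒≤ L₁ (λ z≤v → ∄z (_ , bz , zx , yz , z≤v)) , A⊆ (b⊆A bz))
          (between-large (T? ∘ b) dense by bx y≺x))

    -- Split the interval by `x ≪_`. The points outside are not large by `≪-cofinal`; those inside
    -- are, and `≪-coinitial` finds `z` among them.
    ≪-dense : ¬ Embeddable Ωη P → ¬ Embeddable (Dual Ωη) P →
      ∀ {x y} → x ≪ y → ∃[ z ] x ≪ z × z ≪ y
    ≪-dense ¬Ω ¬Ω* {x} {y} x≪y with large-split x≪y (x ≪_)
    ... | inj₁ large = decidable-stable em λ ∄z →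
          ≪-coinitial ¬Ω* large (proj₂ ∘ proj₁) λ (_ , x≪z) z≪y → ∄z (_ , x≪z , z≪y)
    ... | inj₂ large = ⊥-elim (≪-cofinal ¬Ω large (proj₁ ∘ proj₁) proj₂)

    -- Cutting the set in `L₁` at one of its points leaves a large part bounded on one side, as
    -- `≪-cofinal` or `≪-coinitial` requires.
    large⇒≪ : ¬ Embeddable Ωη P → ¬ Embeddable (Dual Ωη) P →
      {A : Pred Carrier ℓ} → IsLarge A → ∃₂ _≪_
    large⇒≪ ¬Ω ¬Ω* large@(_ , _ , (x , _) , _) = decidable-stable em λ ∄≪ →
      case large-split large (λ z → Lift c (x L₁.≤ z)) of λ where
        (inj₁ above) → ≪-cofinal ¬Ω above (lower ∘ proj₂) λ _ x≪y → ∄≪ (_ , _ , x≪y)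
        (inj₂ below) → ≪-coinitial ¬Ω* below (λ (_ , x≰z) x≤z → x≰z (lift x≤z))
                         λ _ z≪x → ∄≪ (_ , _ , z≪x)

    -- A copy of ℚ in `L₂` is large, so `_≪_` relates some pair; being dense and contained in the
    -- strict order of `L₁`, it yields ℚ there.
    scattered-complement : ¬ Embeddable Ωη P → ¬ Embeddable (Dual Ωη) P →
      Scattered L₁.poset → Scattered L₂.poset
    scattered-complement ¬Ω ¬Ω* sc₁ ℚ↪L₂ with orderEmbedding ℚ-poset L₂.poset ℚ↪L₂
    ... | f , mono , cancel = sc₁
      (dense⇒ℚ-embeddable (lowerEM _ em) L₁ id ≪⇒≱ (≪-dense ¬Ω ¬Ω*)
        (proj₂ (proj₂ (large⇒≪ ¬Ω ¬Ω* (dense⇒large {S = S} (λ _ → lowerEM ℓ₂ em) dense)))))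
      where
      S : Pred Carrier c
      S x = ∃[ q ] f q ≡ x

      f-mono-≺ : ∀ {p q} → p ℚ.< q → f p ≺ f q
      f-mono-≺ p<q fq≤fp = ℚ.<-irrefl refl (ℚ.<-≤-trans p<q (cancel fq≤fp))

      dense : Dense S
      dense =
        (f ℚ.0ℚ , f ℚ.1ℚ , (ℚ.0ℚ , refl) , (ℚ.1ℚ , refl) , f-mono-≺ 0<1) ,
        λ { (p , refl) (q , refl) p≺q →
          let r , p<r , r<q = ℚ.<-dense (ℚ.≰⇒> λ q≤p → p≺q (mono q≤p))
          in f r , (r , refl) , f-mono-≺ p<r , f-mono-≺ r<q }
        where
        0<1 : ℚ.0ℚ ℚ.< ℚ.1ℚ
        0<1 = ℚ.positive⁻¹ ℚ.1ℚ

-- The complement of a non-separating extension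

module _ {c ℓ₁ ℓ₂} (em : ExcludedMiddle ℓ₂) (P : Poset c ℓ₁ ℓ₂) (L : LinearOrderOn P)
         (P⊆L : IsLinearExtension P L) (nonsep : ¬ Separating P L) where
  private
    module P = Poset P
    module L = LinearOrderOn L
    module O = IsTotalOrder L.isTotalOrder

  _≤ᶜ_ : Rel P.Carrier ℓ₂
  x ≤ᶜ y = x P.≤ y ⊎ Incomparable P x y × y L.≤ x

  swap-incomparable : ∀ {x y} → Incomparable P x y → Incomparable P y x
  swap-incomparable (x≰y , y≰x) = y≰x , x≰y

  -- Incomparable elements are distinct, so the weak inequalities are strict; `x ≈ z` would squeeze
  -- `y` between equal elements.
  nonseparating : ∀ {x y z} → x P.≤ z → Incomparable P y x → Incomparable P y z →
                  x L.≤ y → y L.≤ z → ⊥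
  nonseparating x≤z y∥x y∥z x≤y y≤z = nonsep (_ , _ , _ ,
    (x≤z , λ x≈z → proj₁ y∥z (P.reflexive (O.antisym y≤z
      (O.trans (O.reflexive (P.Eq.sym x≈z)) x≤y)))) , y∥x , y∥z ,
    (x≤y , λ x≈y → proj₂ y∥x (P.reflexive x≈y)) ,
    (y≤z , λ y≈z → proj₁ y∥z (P.reflexive y≈z)))

  ≤ᶜ-total : ∀ x y → x ≤ᶜ y ⊎ y ≤ᶜ x
  ≤ᶜ-total x y with em {x P.≤ y} | em {y P.≤ x} | O.total x y
  ... | yes x≤y | _       | _        = inj₁ (inj₁ x≤y)
  ... | no _    | yes y≤x | _        = inj₂ (inj₁ y≤x)
  ... | no x≰y  | no y≰x  | inj₁ x≤y = inj₂ (inj₂ ((y≰x , x≰y) , x≤y))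
  ... | no x≰y  | no y≰x  | inj₂ y≤x = inj₁ (inj₂ ((x≰y , y≰x) , y≤x))

  ≤ᶜ-antisym : ∀ {x y} → x ≤ᶜ y → y ≤ᶜ x → x P.≈ y
  ≤ᶜ-antisym (inj₁ x≤y)               (inj₁ y≤x)               = P.antisym x≤y y≤x
  ≤ᶜ-antisym (inj₁ x≤y)               (inj₂ ((_ , x≰y) , _))   = contradiction x≤y x≰y
  ≤ᶜ-antisym (inj₂ ((_ , y≰x) , _))   (inj₁ y≤x)               = contradiction y≤x y≰x
  ≤ᶜ-antisym (inj₂ (_ , y≤x))         (inj₂ (_ , x≤y))         = O.antisym x≤y y≤x

  -- Where transitivity could fail, some element would lie in `L` between two `P`-comparable ones
  -- while incomparable to both.
  ≤ᶜ-trans : Transitive _≤ᶜ_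
  ≤ᶜ-trans (inj₁ x≤y) (inj₁ y≤z) = inj₁ (P.trans x≤y y≤z)
  ≤ᶜ-trans {x} {y} {z} (inj₁ x≤y) (inj₂ (y∥z@(_ , z≰y) , z≤y)) with em {x P.≤ z} | O.total x z
  ... | yes x≤z | _         = inj₁ x≤z
  ... | no x≰z  | inj₂ z≤x  = inj₂ ((x≰z , λ z≤x → z≰y (P.trans z≤x x≤y)) , z≤x)
  ... | no x≰z  | inj₁ x≤z  = ⊥-elim (nonseparating x≤y
    ((λ z≤x → z≰y (P.trans z≤x x≤y)) , x≰z) (swap-incomparable y∥z) x≤z z≤y)
  ≤ᶜ-trans {x} {y} {z} (inj₂ (x∥y@(_ , y≰x) , y≤x)) (inj₁ y≤z) with em {x P.≤ z} | O.total x z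
  ... | yes x≤z | _         = inj₁ x≤z
  ... | no x≰z  | inj₂ z≤x  = inj₂ ((x≰z , λ z≤x → y≰x (P.trans y≤z z≤x)) , z≤x)
  ... | no x≰z  | inj₁ x≤z  = ⊥-elim (nonseparating y≤z x∥y
    (x≰z , λ z≤x → y≰x (P.trans y≤z z≤x)) y≤x x≤z)
  ≤ᶜ-trans {x} {y} {z} (inj₂ (x∥y , y≤x)) (inj₂ (y∥z , z≤y)) with em {x P.≤ z} | em {z P.≤ x}
  ... | yes x≤z | _       = inj₁ x≤z
  ... | no _    | yes z≤x = ⊥-elim (nonseparating z≤x y∥z (swap-incomparable x∥y) z≤y y≤x)
  ... | no x≰z  | no z≰x  = inj₂ ((x≰z , z≰x) , O.trans z≤y y≤x)

  complement : LinearOrderOn P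
  complement = record
    { _≤_ = _≤ᶜ_
    ; isTotalOrder = record
      { isPartialOrder = record
        { isPreorder = record
          { isEquivalence = P.isEquivalence
          ; reflexive     = inj₁ ∘ P.reflexive
          ; trans         = ≤ᶜ-trans
          }
        ; antisym = ≤ᶜ-antisym
        }
      ; total = ≤ᶜ-total
      }
    }

  complement-intersection : IsIntersectionOf P L complement
  complement-intersection = (λ x≤y → P⊆L x≤y , inj₁ x≤y) , λ where
    (_   , inj₁ x≤y)                    → x≤y
    (x≤y , inj₂ (_ , y≤x)) → P.reflexive (O.antisym x≤y y≤x)

-- Assembling the two implications

theorem13 : ∀ {c ℓ₁ ℓ₂} → ExcludedMiddle (c ⊔ ℓ₁ ⊔ ℓ₂) → (P : Poset c ℓ₁ ℓ₂) →
    (Σ[ L₁ ∈ LinearOrderOn P ] Σ[ L₂ ∈ LinearOrderOn P ]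
    Scattered (LinearOrderOn.poset L₁) × Scattered (LinearOrderOn.poset L₂) × IsIntersectionOf P L₁ L₂)
    ⇔
    ((Σ[ L ∈ LinearOrderOn P ]
    IsLinearExtension P L × ¬ Separating P L × Scattered (LinearOrderOn.poset L))
    × (¬ Embeddable Ωη P × ¬ Embeddable (Dual Ωη) P))
theorem13 {c} {ℓ₁} {ℓ₂} em P = mk⇔
  (λ (L₁ , L₂ , sc₁ , sc₂ , P≐L₁∩L₂) →
    (L₁ , proj₁ ∘ proj₁ P≐L₁∩L₂ , intersection-nonseparating L₁ L₂ P≐L₁∩L₂ , sc₁) ,
    scattered-intersection⇒¬Ωη (lowerEM _ em) L₁ L₂ P≐L₁∩L₂ sc₁ sc₂ ,
    -- The reversed orders are scattered and realize `Dual P`, which therefore contains no Ω(η).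
    λ Ω*↪P → scattered-intersection⇒¬Ωη (lowerEM _ em) (dualOrder L₁) (dualOrder L₂)
      (dualIntersection L₁ L₂ P≐L₁∩L₂) (dualScattered L₁ sc₁) (dualScattered L₂ sc₂)
      (embeddable-dual Ωη P Ω*↪P))
  (λ ((L , P⊆L , nonsep , sc) , ¬Ω , ¬Ω*) →
    let L′     = complement (lowerEM (c ⊔ ℓ₁) em) P L P⊆L nonsep
        P≐L∩L′ = complement-intersection (lowerEM (c ⊔ ℓ₁) em) P L P⊆L nonsep
    in L , L′ , sc ,
       Large.scattered-complement (lowerEM ℓ₁ em) L L′ P≐L∩L′ ¬Ω ¬Ω* sc , P≐L∩L′)
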